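{- Algorithm 1 (defined in the context) exhibits unbounded robustness for the preemptive FIFO buffer management problem; that is, there is no finite $\beta$ for which it is $\beta$-robust, where $\beta$-robust means $$\sup_{\sigma,\hat\sigma}\ \frac{v(\mathrm{OPT}(\sigma))}{v(\mathrm{ALG}(\sigma,\hat\sigma))}\le\beta$$ and $\mathrm{ALG}(\sigma,\hat\sigma)$ is the schedule of Algorithm 1 on actual input $\sigma$ and (arbitrary) predicted input $\hat\sigma$.
   Context: Preemptive FIFO buffer management. A buffer has fixed finite capacity. Time is discrete, $i\in\{1,\dots,T\}$. An input is $\sigma=(\sigma_1,\dots,\sigma_T)$, where $\sigma_i=(p_{i_1},\dots,p_{i_k})$, $k\in\mathbb{Z}_+$, is the sequence of packets arriving at step $i$; each packet $p$ has a nonnegative real value $v(p)$. Each step has two phases. Arrival phase: for each arriving packet in turn, the algorithm immediately accepts or drops it, and it may preempt (permanently discard) any packets in the buffer; an accepted packet is placed at the tail of the buffer, and the capacity may never be exceeded. Transmission phase: after all arrivals of the step, the packet at the head of the buffer (if any) is transmitted and its value is gained. Notation. A schedule is the set of packets transmitted; its value $v(\cdot)$ is the sum of their values. $\mathrm{OPT}(\sigma)$ is an offline optimal schedule (maximum total transmitted value) for $\sigma$. A prediction $\hat\sigma$ is a sequence of the same form as $\sigma$, known to the algorithm in advance; $\sigma$ is revealed online. Algorithm 1 (input: $\sigma$, $\hat\sigma$). Compute an offline optimal schedule $\mathrm{OPT}(\hat\sigma)$ for the prediction. For each step $i=1,\dots,T$: process the arrivals $\sigma_i$ identically to $\mathrm{OPT}(\hat\sigma)$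 (same accept/drop/preempt decisions), then transmit the head packet of the buffer. -}

module Defs where

open import Algebra.Bundles using (CommutativeRing)
open import Data.Bool using (Bool; true; false; not; if_then_else_; _∧_)
open import Data.List using (List; []; _∷_; _++_; [_]; length; filterᵇ; foldr; take; drop)
open import Data.Nat using (ℕ; suc; _<_; _<ᵇ_)
open import Data.Product using (Σ; _×_; _,_; proj₁)
open import Data.Unit using (⊤)
open import Data.Vec using (Vec; []; _∷_)
open import Function using (_∘_)
open import Level using (Level; _⊔_) renaming (suc to lsuc)
open import Relation.Binary.Core using (Rel)
open import Relation.Binary.PropositionalEquality using (_≡_)
open import Relation.Binary.Structures using (IsTotalOrder)
open import Relation.Nullary using (¬_)

-- The standard library has no real numbers.  Packet values and the bound β
-- are taken in an arbitrary totally ordered field, of which ℝ is an instance.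
record OrderedField (c ℓ₁ ℓ₂ : Level) : Set (lsuc (c ⊔ ℓ₁ ⊔ ℓ₂)) where
  infix 4 _≤_
  field
    commutativeRing : CommutativeRing c ℓ₁
  open CommutativeRing commutativeRing public
  field
    _≤_          : Rel Carrier ℓ₂
    isTotalOrder : IsTotalOrder _≈_ _≤_
    +-monoˡ-≤    : ∀ z {x y} → x ≤ y → x + z ≤ y + z
    *-nonNeg     : ∀ {x y} → 0# ≤ x → 0# ≤ y → 0# ≤ x * y
    0≉1          : ¬ 0# ≈ 1#
    inv          : ∀ x → ¬ x ≈ 0# → Carrier
    *-inverseʳ   : ∀ x (x≉0 : ¬ x ≈ 0#) → x * inv x x≉0 ≈ 1#

-- B is the capacity of the buffer.
module FIFO {c ℓ₁ ℓ₂} (F : OrderedField c ℓ₁ ℓ₂) (B : ℕ) where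
  open OrderedField F

  Value : Set (c ⊔ ℓ₂)
  Value = Σ Carrier (0# ≤_)

  -- The i-th entry lists the values of the packets arriving at step i, in
  -- order of arrival.
  Input : ℕ → Set (c ⊔ ℓ₂)
  Input T = Vec (List Value) T

  -- A packet is identified by its step and its position among the arrivals of
  -- that step, both counted from 0.
  Label : Set
  Label = ℕ × ℕ

  record Packet : Set (c ⊔ ℓ₂) where
    constructor packet
    field
      label : Label
      value : Value
  open Packet public

  -- Head first.
  Buffer : Set (c ⊔ ℓ₂)
  Buffer = List Packet

  -- The reaction to one arrival: the buffered packets to preempt, and whether
  -- the arriving packet is then accepted.
  record Decision : Set where
    constructor decision
    field
      accept  : Bool
      preempt : Label → Bool
  open Decision public

  -- π i j is the decision on the arrival labelled (i , j).  Decisions do not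
  -- refer to values, so a plan made for one input can be carried out on
  -- another.
  Plan : Set
  Plan = ℕ → ℕ → Decision

  kept : Decision → Buffer → Buffer
  kept d = filterᵇ (not ∘ preempt d ∘ label)

  -- Accepting into a full buffer has no effect, so the capacity is never
  -- exceeded, whatever plan is carried out on whatever input.
  arrive : Decision → Packet → Buffer → Buffer
  arrive d p b =
    if accept d ∧ (length (kept d b) <ᵇ B) then kept d b ++ [ p ] else kept d b

  -- i is the current step, j the position of the next arrival.
  arrivalPhase : Plan → (i j : ℕ) → List Value → Buffer → Buffer
  arrivalPhase π i j []       b = b
  arrivalPhase π i j (v ∷ vs) b =
    arrivalPhase π i (suc j) vs (arrive (π i j) (packet (i , j) v) b)

  -- The packets transmitted from step i on, starting with buffer b.
  transmittedFrom : ∀ {T} → Plan → ℕ → Input T → Buffer → List Packet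
  transmittedFrom π i []       b = []
  transmittedFrom π i (a ∷ σ) b =
    let b′ = arrivalPhase π i 0 a b
    in take 1 b′ ++ transmittedFrom π (suc i) σ (drop 1 b′)

  schedule : ∀ {T} → Plan → Input T → List Packet
  schedule π σ = transmittedFrom π 0 σ []

  v : List Packet → Carrier
  v = foldr (λ p s → proj₁ (value p) + s) 0#

  -- On the given input the plan accepts only when there is room.
  FitsArrivals : Plan → (i j : ℕ) → List Value → Buffer → Set
  FitsArrivals π i j []       b = ⊤
  FitsArrivals π i j (x ∷ xs) b =
    (accept (π i j) ≡ true → length (kept (π i j) b) < B) ×
    FitsArrivals π i (suc j) xs (arrive (π i j) (packet (i , j) x) b)

  FitsFrom : ∀ {T} → Plan → ℕ → Input T → Buffer → Set
  FitsFrom π i []       b = ⊤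
  FitsFrom π i (a ∷ σ) b =
    FitsArrivals π i 0 a b ×
    FitsFrom π (suc i) σ (drop 1 (arrivalPhase π i 0 a b))

  Feasible : ∀ {T} → Plan → Input T → Set
  Feasible π σ = FitsFrom π 0 σ []

  record IsOptimal {T} (σ : Input T) (π : Plan) : Set ℓ₂ where
    field
      feasible : Feasible π σ
      maximal  : ∀ π′ → Feasible π′ σ → v (schedule π′ σ) ≤ v (schedule π σ)

  -- A choice of an offline optimal solution for every input.
  record OfflineOptimum : Set (c ⊔ ℓ₂) where
    field
      plan    : ∀ {T} → Input T → Plan
      optimal : ∀ {T} (σ : Input T) → IsOptimal σ (plan σ)

  -- x / y ≤ β for nonnegative x and y, where x / 0 = ∞ for x > 0, and 0 / 0
  -- imposes no condition (it arises when nothing of positive value arrives).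
  RatioAtMost : (x y β : Carrier) → Set (ℓ₁ ⊔ ℓ₂)
  RatioAtMost x y β =
    ((y≉0 : ¬ y ≈ 0#) → x * inv y y≉0 ≤ β) × (y ≈ 0# → x ≈ 0#)

  module _ (opt : OfflineOptimum) where
    open OfflineOptimum opt

    OPT : ∀ {T} → Input T → List Packet
    OPT σ = schedule (plan σ) σ

    -- The decisions made for the prediction σ̂, carried out on σ.  Optimality
    -- for σ̂ does not constrain plan σ̂ at labels that do not occur in σ̂, so
    -- ranging over all opt covers every treatment of arrivals of σ that have
    -- no counterpart in σ̂, dropping them in particular.
    ALG : ∀ {T} → Input T → Input T → List Packet
    ALG σ σ̂ = schedule (plan σ̂) σ

    Robust : Carrier → Set (c ⊔ ℓ₁ ⊔ ℓ₂)
    Robust β = ∀ {T} (σ σ̂ : Input T) → RatioAtMost (v (OPT σ)) (v (ALG σ σ̂)) β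

{-# OPTIONS --safe #-}
-- Two packets arrive in a single step, so only one of them is transmitted, and
-- which one depends on the plan but not on the values.  If the values 0 , 1 are
-- predicted, an optimal plan transmits the second packet; on the actual values
-- 1 , 0 it then gains 0, while the optimum gains 1.
module Submission where

open import Algebra.Properties.Ring using (-1*x≈-x; -‿involutive)
open import Data.Bool using (true; false)
open import Data.List using ([]; _∷_; [_])
open import Data.Nat using (ℕ; suc; _≤_; s≤s; z≤n; _≡ᵇ_; _<ᵇ_)
open import Data.Product using (∃; _,_; proj₂)
open import Data.Sum using (_⊎_; inj₁; inj₂; [_,_]′)
open import Data.Unit using (tt)
open import Data.Vec using ([]; _∷_)
open import Function using (const; id)
open import Relation.Binary.PropositionalEquality using (_≡_; refl; cong)
open import Relation.Binary.Structures using (IsTotalOrder)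
open import Relation.Nullary using (¬_; contradiction)
open import Defs

module OrderedFieldProperties {c ℓ₁ ℓ₂} (F : OrderedField c ℓ₁ ℓ₂) where
  open OrderedField F renaming (_≤_ to _≤ᶠ_)
  open IsTotalOrder isTotalOrder using (antisym; total; ≤-respˡ-≈; ≤-respʳ-≈)

  x≤0⇒0≤-x : ∀ {x} → x ≤ᶠ 0# → 0# ≤ᶠ - x
  x≤0⇒0≤-x {x} x≤0 =
    ≤-respˡ-≈ (-‿inverseʳ x) (≤-respʳ-≈ (+-identityˡ (- x)) (+-monoˡ-≤ (- x) x≤0))

  -1*-1≈1 : - 1# * - 1# ≈ 1#
  -1*-1≈1 = trans (-1*x≈-x ring (- 1#)) (-‿involutive ring 1#)

  -- By totality: if `1# ≤ᶠ 0#`, then `- 1#` is nonnegative, and so is its square, which is `1#`.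
  0≤1 : 0# ≤ᶠ 1#
  0≤1 = [ id , (λ 1≤0 → ≤-respʳ-≈ -1*-1≈1 (*-nonNeg (x≤0⇒0≤-x 1≤0) (x≤0⇒0≤-x 1≤0))) ]′
    (total 0# 1#)

  1≰0 : ¬ 1# ≤ᶠ 0#
  1≰0 1≤0 = 0≉1 (antisym 0≤1 1≤0)

module TwoArrivals {c ℓ₁ ℓ₂} (F : OrderedField c ℓ₁ ℓ₂) (B : ℕ) where
  open FIFO F (suc B)

  two : Value → Value → Input 1
  two x y = (x ∷ y ∷ []) ∷ []

  -- The quantifiers over values are inside the alternatives: the case that
  -- occurs does not depend on the input.
  schedule-two : ∀ π →
    (∀ x y → schedule π (two x y) ≡ []) ⊎
    (∀ x y → schedule π (two x y) ≡ [ packet (0 , 0) x ]) ⊎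
    (∀ x y → schedule π (two x y) ≡ [ packet (0 , 1) y ])
  schedule-two π with π 0 0 | π 0 1
  ... | decision false _ | decision false _ = inj₁ λ _ _ → refl
  ... | decision false _ | decision true _  = inj₂ (inj₂ λ _ _ → refl)
  ... | decision true _  | decision a pre with pre (0 , 0) | a
  ...   | false | false = inj₂ (inj₁ λ _ _ → refl)
  ...   | true  | false = inj₁ λ _ _ → refl
  ...   | true  | true  = inj₂ (inj₂ λ _ _ → refl)
  -- The test is whether the second packet fits behind the first; either way the first stays at the
  -- head and is transmitted.
  ...   | false | true with 0 <ᵇ B
  ...     | false = inj₂ (inj₁ λ _ _ → refl)
  ...     | true  = inj₂ (inj₁ λ _ _ → refl)

  -- Competitors for `maximal`: they bound the optimum from below by the value of the packet at
  -- position `k`.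
  acceptOnly : ℕ → Plan
  acceptOnly k _ j = decision (j ≡ᵇ k) (const false)

  acceptOnly-0-feasible : ∀ x y → Feasible (acceptOnly 0) (two x y)
  acceptOnly-0-feasible _ _ = (const (s≤s z≤n) , (λ ()) , tt) , tt

  acceptOnly-1-feasible : ∀ x y → Feasible (acceptOnly 1) (two x y)
  acceptOnly-1-feasible _ _ = ((λ ()) , const (s≤s z≤n) , tt) , tt

module Unbounded {c ℓ₁ ℓ₂} (F : OrderedField c ℓ₁ ℓ₂) (B : ℕ)
                 (opt : FIFO.OfflineOptimum F (suc B)) where
  open OrderedField F hiding (refl) renaming (_≤_ to _≤ᶠ_)
  open IsTotalOrder isTotalOrder using (≤-respˡ-≈; ≤-respʳ-≈) renaming (refl to ≤ᶠ-refl)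
  open OrderedFieldProperties F
  open FIFO F (suc B)
  open TwoArrivals F B
  open OfflineOptimum opt

  zeroᵛ oneᵛ : Value
  zeroᵛ = 0# , ≤ᶠ-refl
  oneᵛ  = 1# , 0≤1

  actual predicted : Input 1
  actual    = two oneᵛ zeroᵛ
  predicted = two zeroᵛ oneᵛ

  1≤OPT-actual : 1# ≤ᶠ v (OPT opt actual)
  1≤OPT-actual = ≤-respˡ-≈ (+-identityʳ 1#)
    (IsOptimal.maximal (optimal actual) (acceptOnly 0) (acceptOnly-0-feasible oneᵛ zeroᵛ))

  1≤OPT-predicted : 1# ≤ᶠ v (OPT opt predicted)
  1≤OPT-predicted = ≤-respˡ-≈ (+-identityʳ 1#)
    (IsOptimal.maximal (optimal predicted) (acceptOnly 1) (acceptOnly-1-feasible zeroᵛ oneᵛ))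

  OPT-predicted≉0 : ¬ v (OPT opt predicted) ≈ 0#
  OPT-predicted≉0 eq = 1≰0 (≤-respʳ-≈ eq 1≤OPT-predicted)

  ALG≈0 : v (ALG opt actual predicted) ≈ 0#
  ALG≈0 with schedule-two (plan predicted)
  ... | inj₁ none          = reflexive (cong v (none oneᵛ zeroᵛ))
  -- Such a plan would gain 0 on `predicted` as well, against its optimality there.
  ... | inj₂ (inj₁ first)  = contradiction
    (trans (reflexive (cong v (first zeroᵛ oneᵛ))) (+-identityʳ 0#)) OPT-predicted≉0
  ... | inj₂ (inj₂ second) =
    trans (reflexive (cong v (second oneᵛ zeroᵛ))) (+-identityʳ 0#)

  ¬robust : ∀ β → ¬ Robust opt β
  ¬robust β robust =
    -- The ratio has denominator 0, so the second clause of `RatioAtMost` forces the optimum to be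
    -- 0, whatever `β` is.
    1≰0 (≤-respʳ-≈ (proj₂ (robust actual predicted) ALG≈0) 1≤OPT-actual)

theorem9 : ∀ {c ℓ₁ ℓ₂} (F : OrderedField c ℓ₁ ℓ₂) (B : ℕ) → 1 ≤ B → (opt : FIFO.OfflineOptimum F B) →
    ¬ (∃ λ β → FIFO.Robust F B opt β)
theorem9 F (suc B) _ opt (β , robust) = Unbounded.¬robust F B opt β robust
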